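{- Let $\Gamma$ be a graph, let $G \leq \mathrm{Aut}(\Gamma)$ be such that $\Gamma/G$ is a tree, and let $\Gamma'$ be a subgraph of $\Gamma$ that is mapped isomorphically onto $\Gamma/G$ by the quotient map $x\mapsto x^G$. Then $\Gamma$ is connected if and only if $G = \langle G_v \mid v \in V(\Gamma') \rangle$.
   Context: A graph is a quadruple $(V,D,\mathrm{beg},\mathrm{inv})$ where $V$ is a non-empty set of vertices, $D$ is a set of darts (disjoint from $V$), $\mathrm{beg}\colon D\to V$, and $\mathrm{inv}\colon D\to D$ satisfies $\mathrm{inv}\,\mathrm{inv}\,x=x$ for all $x\in D$. For $\Gamma=(V,D,\mathrm{beg},\mathrm{inv})$ write $V(\Gamma)=V$, $D(\Gamma)=D$; $x^{ -1}:=\mathrm{inv}\,x$ and $\mathrm{end}\,x:=\mathrm{beg}\,x^{ -1}$. A subgraph of $\Gamma$ is a graph $(V',D',\mathrm{beg}',\mathrm{inv}')$ with $V'\subseteq V$, $D'\subseteq D$ and $\mathrm{beg}',\mathrm{inv}'$ the restrictions of $\mathrm{beg},\mathrm{inv}$ to $D'$. A walk is a sequence of darts $(x_1,\dots,x_n)$ with $\mathrm{end}\,x_i=\mathrm{beg}\,x_{i+1}$; a walk of length $0$ is regarded as a walk from any vertex to itself. A graph is connected if for any two vertices $u,v$ there is a walk from $u$ to $v$. An edge is a pair $\{x,x^{ -1}\}$; it is a semi-edge if $x=x^{ -1}$ and a loop if $x\ne x^{ -1}$ but $\mathrm{beg}\,x=\mathrm{end}\,x$; two distinct edges are parallel if they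 have the same endvertices. A graph is simple if it has no semi-edges, loops, or pairs of distinct parallel edges. A tree is a connected graph with no cycles; a tree is always a simple graph (so this is a tree in the usual sense for simple graphs). A morphism of graphs is a function mapping vertices to vertices and darts to darts and commuting with $\mathrm{beg}$ and $\mathrm{inv}$; isomorphisms are bijective morphisms, automorphisms are isomorphisms of a graph onto itself; $\mathrm{Aut}(\Gamma)$ acts on the right, with the image of $x$ under $g$ denoted $x^g$. For $G\le\mathrm{Aut}(\Gamma)$, $x^G$ is the $G$-orbit of $x$, $G_x$ is the stabiliser of $x$ in $G$, and $\Gamma/G$ is the graph whose vertices and darts are the $G$-orbits on $V(\Gamma)$ and on $D(\Gamma)$, with $\mathrm{beg}(x^G)=(\mathrm{beg}\,x)^G$ and $\mathrm{inv}(x^G)=(\mathrm{inv}\,x)^G$. The quotient map is $x\mapsto x^G$ on $V(\Gamma)\cup D(\Gamma)$. -}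

module Defs where

open import Algebra.Bundles using (Group)
open import Data.List.Base using (List; []; _∷_; length)
open import Data.List.Relation.Unary.AllPairs using (AllPairs)
open import Data.Nat.Base using (_≤_)
open import Data.Product.Base using (Σ; ∃; _×_; _,_; proj₁; proj₂)
open import Data.Sum.Base using (_⊎_)
open import Function.Base using (_∘_)
open import Function.Bundles using (Func)
open import Function.Definitions using (Bijective)
import Function.Construct.Composition as Composition
import Function.Construct.Identity as Identity
import Function.Construct.Symmetry as Symmetry
open import Level using (Level; _⊔_; suc)
open import Relation.Binary.Bundles using (Setoid)
import Relation.Binary.Construct.On as On
open import Relation.Binary.Definitions using (_Respects_)
open import Relation.Nullary.Negation.Core using (¬_)
open import Relation.Unary using (Pred; _∈_)

private
  variable
    c c′ c″ ℓ ℓ′ ℓ″ p q s : Level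

-- Vertices and darts form setoids rather than bare types, so that a quotient
-- graph is again a graph: its carriers are unchanged and its equality is
-- "lies in the same orbit".
record Graph c ℓ : Set (suc (c ⊔ ℓ)) where
  field
    V : Setoid c ℓ
    D : Setoid c ℓ

  module V = Setoid V
  module D = Setoid D

  field
    nonempty       : V.Carrier
    beg            : D.Carrier → V.Carrier
    inv            : D.Carrier → D.Carrier
    beg-cong       : ∀ {x y} → x D.≈ y → beg x V.≈ beg y
    inv-cong       : ∀ {x y} → x D.≈ y → inv x D.≈ inv y
    inv-involutive : ∀ x → inv (inv x) D.≈ x

  end : D.Carrier → V.Carrier
  end x = beg (inv x)

module _ (Γ : Graph c ℓ) where
  open Graph Γ

  data IsWalk : V.Carrier → List D.Carrier → V.Carrier → Set (c ⊔ ℓ) where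
    []  : ∀ {u v} → u V.≈ v → IsWalk u [] v
    _∷_ : ∀ {u v x xs} → beg x V.≈ u → IsWalk (end x) xs v → IsWalk u (x ∷ xs) v

  Connected : Set (c ⊔ ℓ)
  Connected = ∀ u v → ∃ λ xs → IsWalk u xs v

  SemiEdge : D.Carrier → Set ℓ
  SemiEdge x = x D.≈ inv x

  Loop : D.Carrier → Set ℓ
  Loop x = ¬ (x D.≈ inv x) × beg x V.≈ end x

  -- Darts stand for the edges {x , inv x} that they determine.
  SameEdge : D.Carrier → D.Carrier → Set ℓ
  SameEdge x y = x D.≈ y ⊎ x D.≈ inv y

  SameEnds : D.Carrier → D.Carrier → Set ℓ
  SameEnds x y = (beg x V.≈ beg y × end x V.≈ end y)
               ⊎ (beg x V.≈ end y × end x V.≈ beg y)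

  Parallel : D.Carrier → D.Carrier → Set ℓ
  Parallel x y = ¬ SameEdge x y × SameEnds x y

  Simple : Set (c ⊔ ℓ)
  Simple = (∀ x → ¬ SemiEdge x) × (∀ x → ¬ Loop x) × (∀ x y → ¬ Parallel x y)

  -- Cycles in the sense of simple graphs.  In a general graph, semi-edges,
  -- loops and pairs of parallel edges would also have to count as cycles;
  -- IsTree excludes those through Simple.
  IsCycle : List D.Carrier → Set (c ⊔ ℓ)
  IsCycle xs = 3 ≤ length xs
             × (∃ λ u → IsWalk u xs u)
             × AllPairs (λ x y → ¬ (beg x V.≈ beg y)) xs

  IsTree : Set (c ⊔ ℓ)
  IsTree = Simple × Connected × (∀ xs → ¬ IsCycle xs)

record Morphism (Γ : Graph c ℓ) (Δ : Graph c′ ℓ′) : Set (c ⊔ ℓ ⊔ c′ ⊔ ℓ′) where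
  private
    module Γ = Graph Γ
    module Δ = Graph Δ
  field
    onV : Func Γ.V Δ.V
    onD : Func Γ.D Δ.D

  open Func onV public using () renaming (to to mapV; cong to mapV-cong)
  open Func onD public using () renaming (to to mapD; cong to mapD-cong)

  field
    beg-comm : ∀ x → mapV (Γ.beg x) Δ.V.≈ Δ.beg (mapD x)
    inv-comm : ∀ x → mapD (Γ.inv x) Δ.D.≈ Δ.inv (mapD x)

record IsIsomorphism {Γ : Graph c ℓ} {Δ : Graph c′ ℓ′} (f : Morphism Γ Δ)
                     : Set (c ⊔ ℓ ⊔ c′ ⊔ ℓ′) where
  private
    module Γ = Graph Γ
    module Δ = Graph Δ
  open Morphism f
  field
    bijV : Bijective Γ.V._≈_ Δ.V._≈_ mapV
    bijD : Bijective Γ.D._≈_ Δ.D._≈_ mapD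

idᴹ : (Γ : Graph c ℓ) → Morphism Γ Γ
idᴹ Γ = record
  { onV      = Identity.function V
  ; onD      = Identity.function D
  ; beg-comm = λ _ → V.refl
  ; inv-comm = λ _ → D.refl
  } where open Graph Γ

-- Diagrammatic order: f first, then g.
infixl 9 _⨾_
_⨾_ : {Γ : Graph c ℓ} {Δ : Graph c′ ℓ′} {Θ : Graph c″ ℓ″} →
      Morphism Γ Δ → Morphism Δ Θ → Morphism Γ Θ
_⨾_ {Θ = Θ} f g = record
  { onV      = Composition.function f.onV g.onV
  ; onD      = Composition.function f.onD g.onD
  ; beg-comm = λ x → V.trans (g.mapV-cong (f.beg-comm x)) (g.beg-comm (f.mapD x))
  ; inv-comm = λ x → D.trans (g.mapD-cong (f.inv-comm x)) (g.inv-comm (f.mapD x))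
  }
  where
  module f = Morphism f
  module g = Morphism g
  open Graph Θ using (module V; module D)

record Automorphism (Γ : Graph c ℓ) : Set (c ⊔ ℓ) where
  field
    morphism      : Morphism Γ Γ
    isIsomorphism : IsIsomorphism morphism
  open Morphism morphism public
  open IsIsomorphism isIsomorphism public

module _ (Γ : Graph c ℓ) where
  open Graph Γ
  open Automorphism using (morphism; mapV; mapD; mapV-cong; mapD-cong; beg-comm; inv-comm; bijV; bijD)

  private
    idᴬ : Automorphism Γ
    idᴬ = record
      { morphism      = idᴹ Γ
      ; isIsomorphism = record
        { bijV = Identity.bijective V._≈_
        ; bijD = Identity.bijective D._≈_
        }
      }

    _∙ᴬ_ : Automorphism Γ → Automorphism Γ → Automorphism Γ
    g ∙ᴬ h = record
      { morphism      = morphism g ⨾ morphism h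
      ; isIsomorphism = record
        { bijV = Composition.bijective V._≈_ V._≈_ V._≈_ (bijV g) (bijV h)
        ; bijD = Composition.bijective D._≈_ D._≈_ D._≈_ (bijD g) (bijD h)
        }
      }

    module _ (g : Automorphism Γ) where
      v⁻¹ : V.Carrier → V.Carrier
      v⁻¹ = proj₁ ∘ proj₂ (bijV g)

      d⁻¹ : D.Carrier → D.Carrier
      d⁻¹ = proj₁ ∘ proj₂ (bijD g)

      mapV-v⁻¹ : ∀ v → mapV g (v⁻¹ v) V.≈ v
      mapV-v⁻¹ v = proj₂ (proj₂ (bijV g) v) V.refl

      mapD-d⁻¹ : ∀ x → mapD g (d⁻¹ x) D.≈ x
      mapD-d⁻¹ x = proj₂ (proj₂ (bijD g) x) D.refl

    _⁻¹ᴬ : Automorphism Γ → Automorphism Γ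
    g ⁻¹ᴬ = record
      { morphism = record
        { onV = record
          { to   = v⁻¹ g
          ; cong = λ e → proj₁ (bijV g) (V.trans (mapV-v⁻¹ g _) (V.trans e (V.sym (mapV-v⁻¹ g _))))
          }
        ; onD = record
          { to   = d⁻¹ g
          ; cong = λ e → proj₁ (bijD g) (D.trans (mapD-d⁻¹ g _) (D.trans e (D.sym (mapD-d⁻¹ g _))))
          }
        ; beg-comm = λ x → proj₁ (bijV g) (V.trans (mapV-v⁻¹ g (beg x))
            (V.sym (V.trans (beg-comm g (d⁻¹ g x)) (beg-cong (mapD-d⁻¹ g x)))))
        ; inv-comm = λ x → proj₁ (bijD g) (D.trans (mapD-d⁻¹ g (inv x))
            (D.sym (D.trans (inv-comm g (d⁻¹ g x)) (inv-cong (mapD-d⁻¹ g x)))))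
        }
      ; isIsomorphism = record
        { bijV = Symmetry.bijective (bijV g) V.refl V.sym V.trans (mapV-cong g)
        ; bijD = Symmetry.bijective (bijD g) D.refl D.sym D.trans (mapD-cong g)
        }
      }

  -- Automorphisms act on the right: g ∙ h applies g first.
  Aut : Group (c ⊔ ℓ) (c ⊔ ℓ)
  Aut = record
    { Carrier = Automorphism Γ
    ; _≈_     = λ g h → (∀ v → mapV g v V.≈ mapV h v) × (∀ x → mapD g x D.≈ mapD h x)
    ; _∙_     = _∙ᴬ_
    ; ε       = idᴬ
    ; _⁻¹     = _⁻¹ᴬ
    ; isGroup = record
      { isMonoid = record
        { isSemigroup = record
          { isMagma = record
            { isEquivalence = record
              { refl  = (λ _ → V.refl) , (λ _ → D.refl)
              ; sym   = λ (p , q) → (λ v → V.sym (p v)) , (λ x → D.sym (q x))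
              ; trans = λ (p , q) (p′ , q′) →
                  (λ v → V.trans (p v) (p′ v)) , (λ x → D.trans (q x) (q′ x))
              }
            ; ∙-cong = λ {_} {g′} {h} (p , q) (p′ , q′) →
                  (λ v → V.trans (mapV-cong h (p v)) (p′ (mapV g′ v)))
                , (λ x → D.trans (mapD-cong h (q x)) (q′ (mapD g′ x)))
            }
          ; assoc = λ _ _ _ → (λ _ → V.refl) , (λ _ → D.refl)
          }
        ; identity = (λ _ → (λ _ → V.refl) , (λ _ → D.refl))
                   , (λ _ → (λ _ → V.refl) , (λ _ → D.refl))
        }
      ; inverse = (λ g → mapV-v⁻¹ g , mapD-d⁻¹ g)
                , (λ g → (λ v → proj₁ (bijV g) (mapV-v⁻¹ g (mapV g v)))
                       , (λ x → proj₁ (bijD g) (mapD-d⁻¹ g (mapD g x))))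
      ; ⁻¹-cong = λ {g} {h} (p , q) →
            (λ v → proj₁ (bijV g) (V.trans (mapV-v⁻¹ g v)
                     (V.sym (V.trans (p (v⁻¹ h v)) (mapV-v⁻¹ h v)))))
          , (λ x → proj₁ (bijD g) (D.trans (mapD-d⁻¹ g x)
                     (D.sym (D.trans (q (d⁻¹ h x)) (mapD-d⁻¹ h x)))))
      }
    }

record Subgroup (𝒢 : Group c ℓ) p : Set (c ⊔ ℓ ⊔ suc p) where
  open Group 𝒢
  field
    Member    : Pred Carrier p
    resp      : Member Respects _≈_
    ε-closed  : ε ∈ Member
    ∙-closed  : ∀ {g h} → g ∈ Member → h ∈ Member → g ∙ h ∈ Member
    ⁻¹-closed : ∀ {g} → g ∈ Member → g ⁻¹ ∈ Member

module _ (𝒢 : Group c ℓ) where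
  open Group 𝒢

  data Generated (S : Pred Carrier p) : Pred Carrier (c ⊔ ℓ ⊔ p) where
    gen      : ∀ {g} → g ∈ S → Generated S g
    gen-resp : ∀ {g h} → g ≈ h → Generated S g → Generated S h
    gen-ε    : Generated S ε
    gen-∙    : ∀ {g h} → Generated S g → Generated S h → Generated S (g ∙ h)
    gen-⁻¹   : ∀ {g} → Generated S g → Generated S (g ⁻¹)

module _ {Γ : Graph c ℓ} (G : Subgroup (Aut Γ) p) where
  open Graph Γ
  open Group (Aut Γ) using (_∙_; _⁻¹; inverseʳ)
  open Subgroup G
  open Automorphism using (mapV; mapD; mapV-cong; mapD-cong; beg-comm; inv-comm)

  Stabiliser : V.Carrier → Pred (Automorphism Γ) (ℓ ⊔ p)
  Stabiliser v g = g ∈ Member × mapV g v V.≈ v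

  orbitsV : Setoid c (c ⊔ ℓ ⊔ p)
  orbitsV = record
    { Carrier       = V.Carrier
    ; _≈_           = λ u v → ∃ λ g → g ∈ Member × mapV g u V.≈ v
    ; isEquivalence = record
      { refl  = _ , ε-closed , V.refl
      ; sym   = λ {u} (g , m , e) → g ⁻¹ , ⁻¹-closed m ,
          V.trans (mapV-cong (g ⁻¹) (V.sym e)) (proj₁ (inverseʳ g) u)
      ; trans = λ (g , m , e) (h , n , f) → g ∙ h , ∙-closed m n ,
          V.trans (mapV-cong h e) f
      }
    }

  orbitsD : Setoid c (c ⊔ ℓ ⊔ p)
  orbitsD = record
    { Carrier       = D.Carrier
    ; _≈_           = λ x y → ∃ λ g → g ∈ Member × mapD g x D.≈ y
    ; isEquivalence = record
      { refl  = _ , ε-closed , D.refl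
      ; sym   = λ {x} (g , m , e) → g ⁻¹ , ⁻¹-closed m ,
          D.trans (mapD-cong (g ⁻¹) (D.sym e)) (proj₂ (inverseʳ g) x)
      ; trans = λ (g , m , e) (h , n , f) → g ∙ h , ∙-closed m n ,
          D.trans (mapD-cong h e) f
      }
    }

infix 8 _/_
_/_ : (Γ : Graph c ℓ) → Subgroup (Aut Γ) p → Graph c (c ⊔ ℓ ⊔ p)
Γ / G = record
  { V              = orbitsV G
  ; D              = orbitsD G
  ; nonempty       = nonempty
  ; beg            = beg
  ; inv            = inv
  ; beg-cong       = λ {x} (g , m , e) → g , m , V.trans (beg-comm g x) (beg-cong e)
  ; inv-cong       = λ {x} (g , m , e) → g , m , D.trans (inv-comm g x) (inv-cong e)
  ; inv-involutive = λ x → _ , ε-closed , inv-involutive x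
  }
  where
  open Graph Γ
  open Subgroup G
  open Automorphism using (beg-comm; inv-comm)

quotientMap : {Γ : Graph c ℓ} (G : Subgroup (Aut Γ) p) → Morphism Γ (Γ / G)
quotientMap {Γ = Γ} G = record
  { onV      = record { to = λ v → v ; cong = λ e → _ , ε-closed , e }
  ; onD      = record { to = λ x → x ; cong = λ e → _ , ε-closed , e }
  ; beg-comm = λ _ → _ , ε-closed , V.refl
  ; inv-comm = λ _ → _ , ε-closed , D.refl
  }
  where
  open Graph Γ
  open Subgroup G

record Subgraph (Γ : Graph c ℓ) s : Set (c ⊔ ℓ ⊔ suc s) where
  open Graph Γ
  field
    V′         : Pred V.Carrier s
    D′         : Pred D.Carrier s
    V′-resp    : V′ Respects V._≈_
    D′-resp    : D′ Respects D._≈_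
    nonempty′  : ∃ V′
    beg-closed : ∀ {x} → x ∈ D′ → beg x ∈ V′
    inv-closed : ∀ {x} → x ∈ D′ → inv x ∈ D′

  graph : Graph (c ⊔ s) ℓ
  graph = record
    { V              = On.setoid {B = Σ V.Carrier V′} V proj₁
    ; D              = On.setoid {B = Σ D.Carrier D′} D proj₁
    ; nonempty       = nonempty′
    ; beg            = λ (x , m) → beg x , beg-closed m
    ; inv            = λ (x , m) → inv x , inv-closed m
    ; beg-cong       = beg-cong
    ; inv-cong       = inv-cong
    ; inv-involutive = λ (x , _) → inv-involutive x
    }

  inclusion : Morphism graph Γ
  inclusion = record
    { onV      = record { to = proj₁ ; cong = λ e → e }
    ; onD      = record { to = proj₁ ; cong = λ e → e }
    ; beg-comm = λ _ → V.refl
    ; inv-comm = λ _ → D.refl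
    }

{-# OPTIONS --safe #-}
-- If Γ is connected then the vertices v ^ h, with v in Γ′ and h in
-- H = ⟨ G_v | v ∈ V(Γ′) ⟩, are closed under adjacency: translating a dart at
-- v ^ h by h⁻¹ gives a dart at v, and the dart of Γ′ in the same orbit also
-- starts at v, so the two differ by an element of G_v.  Hence for every g in G
-- the vertex v ^ g equals v ^ h for some h in H, and g ∙ h⁻¹ lies in G_v.
-- Conversely, Γ′ is connected, and Γ′ ^ g meets Γ′ whenever g lies in G_v for
-- some v in Γ′; so every element of H moves each v in Γ′ within its component.
module Submission where

open import Defs
open import Algebra.Bundles using (Group)
open import Algebra.Properties.Group using (//-rightDividesˡ)
open import Data.List.Base using ([]; _∷_)
open import Data.Product.Base using (∃; _×_; _,_; proj₁; proj₂)
open import Function.Bundles using (_⇔_; mk⇔)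
open import Level using (Level; _⊔_)
open import Relation.Unary using (Pred; _∈_; _⊆_; _≐_)

private
  variable
    c c′ ℓ ℓ′ p s : Level

module _ (Γ : Graph c ℓ) where
  open Graph Γ

  Joined : V.Carrier → V.Carrier → Set (c ⊔ ℓ)
  Joined u v = ∃ λ xs → IsWalk Γ u xs v

module _ {Γ : Graph c ℓ} where
  open Graph Γ

  joined-reflexive : ∀ {u v} → u V.≈ v → Joined Γ u v
  joined-reflexive e = [] , [] e

  joined-respˡ : ∀ {u u′ v} → u′ V.≈ u → Joined Γ u v → Joined Γ u′ v
  joined-respˡ e (_ , [] e′)    = [] , [] (V.trans e e′)
  joined-respˡ e (_ , (b ∷ w)) = _ , V.trans b (V.sym e) ∷ w

  joined-dart : ∀ x → Joined Γ (beg x) (end x)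
  joined-dart x = x ∷ [] , V.refl ∷ [] V.refl

  joined-trans : ∀ {u v w} → Joined Γ u v → Joined Γ v w → Joined Γ u w
  joined-trans (_ , [] e)    q = joined-respˡ e q
  joined-trans (_ , (b ∷ p)) q = _ , b ∷ proj₂ (joined-trans (_ , p) q)

  joined-sym : ∀ {u v} → Joined Γ u v → Joined Γ v u
  joined-sym (_ , [] e) = joined-reflexive (V.sym e)
  joined-sym (_ , _∷_ {x = x} b p) = joined-trans (joined-sym (_ , p))
    (joined-trans (joined-dart (inv x))
      (joined-reflexive (V.trans (beg-cong (inv-involutive x)) b)))

module _ {Γ : Graph c ℓ} {Δ : Graph c′ ℓ′} (f : Morphism Γ Δ) where
  private
    module Δ = Graph Δ
  open Morphism f

  joined-map : ∀ {u v} → Joined Γ u v → Joined Δ (mapV u) (mapV v)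
  joined-map (_ , [] e) = joined-reflexive (mapV-cong e)
  joined-map (_ , _∷_ {x = x} b p) = joined-trans
    (joined-respˡ (Δ.V.trans (mapV-cong (Graph.V.sym Γ b)) (beg-comm x))
      (joined-dart (mapD x)))
    (joined-respˡ (Δ.V.sym (Δ.V.trans (beg-comm _) (Δ.beg-cong (inv-comm x))))
      (joined-map (_ , p)))

module _ {Γ : Graph c ℓ} {Δ : Graph c′ ℓ′} {f : Morphism Γ Δ}
         (iso : IsIsomorphism f) where
  private
    module Γ = Graph Γ
    module Δ = Graph Δ
  open Morphism f
  open IsIsomorphism iso

  -- Surjectivity on darts lifts each step, and injectivity on vertices makes consecutive lifts
  -- meet. The free endpoints `a` and `b` let the induction restart at the end of a lifted dart,
  -- whose image matches the next vertex only up to the equality of `Δ`.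
  joined-lift : ∀ {u v a b} → mapV a Δ.V.≈ u → mapV b Δ.V.≈ v →
                Joined Δ u v → Joined Γ a b
  joined-lift ea eb (_ , [] e) = joined-reflexive
    (proj₁ bijV (Δ.V.trans ea (Δ.V.trans e (Δ.V.sym eb))))
  joined-lift ea eb (_ , _∷_ {x = x} b p) = joined-trans
    (joined-respˡ
      (proj₁ bijV (Δ.V.trans ea (Δ.V.trans (Δ.V.sym b)
        (Δ.V.sym (Δ.V.trans (beg-comm x′) (Δ.beg-cong x′↦x))))))
      (joined-dart x′))
    (joined-lift
      (Δ.V.trans (beg-comm _) (Δ.beg-cong
        (Δ.D.trans (inv-comm x′) (Δ.inv-cong x′↦x))))
      eb (_ , p))
    where
    x′ = proj₁ (proj₂ bijD x)
    x′↦x = proj₂ (proj₂ bijD x) Γ.D.refl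

  connected-lift : Connected Δ → Connected Γ
  connected-lift conn a b =
    joined-lift Δ.V.refl Δ.V.refl (conn (mapV a) (mapV b))

generated⊆member : {𝒢 : Group c ℓ} (G : Subgroup 𝒢 p) {S : Pred (Group.Carrier 𝒢) s} →
  S ⊆ Subgroup.Member G → Generated 𝒢 S ⊆ Subgroup.Member G
generated⊆member G S⊆G = go
  where
  open Subgroup G
  go : Generated _ _ ⊆ Member
  go (gen m)        = S⊆G m
  go (gen-resp e m) = resp e (go m)
  go gen-ε          = ε-closed
  go (gen-∙ m n)    = ∙-closed (go m) (go n)
  go (gen-⁻¹ m)     = ⁻¹-closed (go m)

module _ (Γ : Graph c ℓ) (G : Subgroup (Aut Γ) p) (Γ′ : Subgraph Γ s)
         (iso : IsIsomorphism (Subgraph.inclusion Γ′ ⨾ quotientMap G)) where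
  open Graph Γ
  open Group (Aut Γ) using (_∙_; _⁻¹; inverseˡ; inverseʳ)
  open Subgroup G
  open Subgraph Γ′ hiding (graph; inclusion)
  open Automorphism
  open IsIsomorphism iso using () renaming (bijV to quotient-bijV; bijD to quotient-bijD)

  VertexStabilisers : Pred (Automorphism Γ) _
  VertexStabilisers g = ∃ λ v → v ∈ V′ × g ∈ Stabiliser G v

  H : Pred (Automorphism Γ) _
  H = Generated (Aut Γ) VertexStabilisers

  H⊆G : H ⊆ Member
  H⊆G = generated⊆member G λ (_ , _ , m , _) → m

  vertex-representative : ∀ u → ∃ λ v → v ∈ V′ × ∃ λ g → g ∈ Member × mapV g v V.≈ u
  vertex-representative u with proj₂ quotient-bijV u
  ... | (v , m) , over = v , m , over {v , m} V.refl

  dart-representative : ∀ x → ∃ λ y → y ∈ D′ × ∃ λ g → g ∈ Member × mapD g y D.≈ x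
  dart-representative x with proj₂ quotient-bijD x
  ... | (y , m) , over = y , m , over {y , m} D.refl

  -- Injectivity of the isomorphism on vertices: equality in `Γ / G` is lying in one orbit, so `V′`
  -- meets each vertex orbit at most once.
  representative-unique : ∀ {u v g} → u ∈ V′ → v ∈ V′ → g ∈ Member →
                          mapV g u V.≈ v → u V.≈ v
  representative-unique {u} {v} {g} u∈ v∈ m e =
    proj₁ quotient-bijV {u , u∈} {v , v∈} (g , m , e)

  -- With `Member` in place of `H` every vertex would qualify, by `vertex-representative`; asking
  -- for `H` makes this a property worth carrying along walks.
  InHTranslate : V.Carrier → Set _
  InHTranslate u = ∃ λ v → v ∈ V′ × ∃ λ h → h ∈ H × mapV h v V.≈ u

  translate-dart : ∀ x → InHTranslate (beg x) → InHTranslate (end x)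
  translate-dart x (v , v∈ , h , h∈ , e) with dart-representative (mapD (h ⁻¹) x)
  ... | y , y∈ , k , k∈ , ky≈ =
    -- `k` carries `y` to `mapD (h ⁻¹) x`, so `k ∙ h`, which applies `k` first, carries `y` to `x`
    -- and hence `end y` to `end x`.
    end y , beg-closed (inv-closed y∈) , k ∙ h , gen-∙ (gen (v , v∈ , k∈ , kv≈v)) h∈ , end≈
    where
    v≈ : mapV (h ⁻¹) (beg x) V.≈ v
    v≈ = V.trans (mapV-cong (h ⁻¹) (V.sym e)) (proj₁ (inverseʳ h) v)

    k-beg : mapV k (beg y) V.≈ v
    k-beg = V.trans (beg-comm k y) (V.trans (beg-cong ky≈)
              (V.trans (V.sym (beg-comm (h ⁻¹) x)) v≈))

    -- `beg y` and `v` both lie in `V′` and in one orbit, so they are equal; as `k` sends the first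
    -- to the second, it is a generator of `H`.
    kv≈v : mapV k v V.≈ v
    kv≈v = V.trans
      (mapV-cong k (V.sym (representative-unique (beg-closed y∈) v∈ k∈ k-beg))) k-beg

    khy≈x : mapD (k ∙ h) y D.≈ x
    khy≈x = D.trans (mapD-cong h ky≈) (proj₂ (inverseˡ h) x)

    end≈ : mapV (k ∙ h) (end y) V.≈ end x
    end≈ = V.trans (beg-comm (k ∙ h) (inv y))
             (beg-cong (D.trans (inv-comm (k ∙ h) y) (inv-cong khy≈x)))

  translate-resp : ∀ {u w} → u V.≈ w → InHTranslate u → InHTranslate w
  translate-resp e (v , v∈ , h , h∈ , f) = v , v∈ , h , h∈ , V.trans f e

  translate-joined : ∀ {u w} → Joined Γ u w → InHTranslate u → InHTranslate w
  translate-joined (_ , [] e) t = translate-resp e t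
  translate-joined (_ , _∷_ {x = x} b p) t =
    translate-joined (_ , p) (translate-dart x (translate-resp (V.sym b) t))

  -- A Frattini argument: `H` moves `v` to every vertex of its `G`-orbit and contains the stabiliser
  -- of `v`, so it exhausts `G`.
  connected⇒G⊆H : Connected Γ → Member ⊆ H
  connected⇒G⊆H conn {g} g∈ with nonempty′
  ... | v , v∈ with translate-joined (conn v (mapV g v)) (v , v∈ , _ , gen-ε , V.refl)
  ... | w , w∈ , h , h∈ , hw≈gv =
    gen-resp (//-rightDividesˡ (Aut Γ) h g) (gen-∙ (gen (v , v∈ , gh⁻¹∈ , fix)) h∈)
    where
    gh⁻¹∈ : g ∙ h ⁻¹ ∈ Member
    gh⁻¹∈ = ∙-closed g∈ (⁻¹-closed (H⊆G h∈))

    gh⁻¹v≈w : mapV (g ∙ h ⁻¹) v V.≈ w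
    gh⁻¹v≈w = V.trans (mapV-cong (h ⁻¹) (V.sym hw≈gv)) (proj₁ (inverseʳ h) w)

    -- The walk only yields some `w` in `V′`; that `g ∙ h ⁻¹` sends `v` to `w` forces the two to
    -- coincide.
    fix : mapV (g ∙ h ⁻¹) v V.≈ v
    fix = V.trans gh⁻¹v≈w (V.sym (representative-unique v∈ w∈ gh⁻¹∈ gh⁻¹v≈w))

  connected⇒G≐H : Connected Γ → Member ≐ H
  connected⇒G≐H conn = connected⇒G⊆H conn , H⊆G

  module _ (conn : Connected (Γ / G)) where

    subgraph-joined : ∀ {u v} → u ∈ V′ → v ∈ V′ → Joined Γ u v
    subgraph-joined u∈ v∈ =
      joined-map (Subgraph.inclusion Γ′) (connected-lift iso conn (_ , u∈) (_ , v∈))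

    -- Induction on the generation of `g`, with `v` free because each generator fixes its own vertex
    -- of `V′`.
    H-joined : ∀ {g} → g ∈ H → ∀ {v} → v ∈ V′ → Joined Γ v (mapV g v)
    -- Walk inside Γ′ from `v` to the fixed vertex `w`, then along the image under `g` of a walk
    -- from `w` back to `v`.
    H-joined {g} (gen (w , w∈ , _ , fix)) v∈ = joined-trans
      (joined-trans (subgraph-joined v∈ w∈) (joined-reflexive (V.sym fix)))
      (joined-map (morphism g) (subgraph-joined w∈ v∈))
    H-joined (gen-resp e m) v∈ =
      joined-trans (H-joined m v∈) (joined-reflexive (proj₁ e _))
    H-joined gen-ε v∈ = joined-reflexive V.refl
    -- First from `v` to its image under `h`, then along the `h`-image of the walk obtained for the
    -- left factor.
    H-joined (gen-∙ {h = h} m n) v∈ =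
      joined-trans (H-joined n v∈) (joined-map (morphism h) (H-joined m v∈))
    H-joined (gen-⁻¹ {g = g} m) v∈ = joined-sym (joined-trans
      (joined-map (morphism (g ⁻¹)) (H-joined m v∈))
      (joined-reflexive (proj₁ (inverseʳ g) _)))

    -- Each vertex is a translate of its representative by an element of `G`, hence of `H`, so it is
    -- joined to that representative; representatives are joined within Γ′.
    G≐H⇒connected : Member ≐ H → Connected Γ
    G≐H⇒connected (G⊆H , _) u w with vertex-representative u | vertex-representative w
    ... | a , a∈ , g , g∈ , ga≈u | b , b∈ , h , h∈ , hb≈w = joined-trans
      (joined-sym (joined-trans (H-joined (G⊆H g∈) a∈) (joined-reflexive ga≈u)))
      (joined-trans (subgraph-joined a∈ b∈)
        (joined-trans (H-joined (G⊆H h∈) b∈) (joined-reflexive hb≈w)))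

proposition5 : ∀ {c ℓ p s : Level} (Γ : Graph c ℓ) (G : Subgroup (Aut Γ) p) →
    IsTree (Γ / G) →
    (Γ′ : Subgraph Γ s) →
    IsIsomorphism (Subgraph.inclusion Γ′ ⨾ quotientMap G) →
    Connected Γ ⇔
    (Subgroup.Member G ≐
    Generated (Aut Γ) (λ g → ∃ λ v → v ∈ Subgraph.V′ Γ′ × g ∈ Stabiliser G v))
proposition5 Γ G (_ , conn , _) Γ′ iso = mk⇔
  (connected⇒G≐H Γ G Γ′ iso)
  (G≐H⇒connected Γ G Γ′ iso conn)
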